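{- Let $G$ be a finite simple graph satisfying the NC property. Then $\chi_{DP}(G) \le \omega(G) + 1$. Moreover, if $G$ is $K_n$-minor-free, then $\chi_{DP}(G) \le n-1$.
   Context: A hole of a graph is an induced cycle of length at least $4$; a graph is chordal if it has no hole. A nonempty set $X\subseteq V(G)$ is a hole cover of $G$ if every hole of $G$ contains at least one vertex of $X$ (so if $G$ is chordal, every nonempty vertex set is a hole cover). A vertex $u$ satisfies the NC property in $G$ if no hole of $G$ containing $u$ and hole of $G$ not containing $u$ share two consecutive edges (two edges with a common end that are consecutive on both holes). A set $\mathcal{C}\subseteq V(G)$ satisfies the NC property in $G$ if every vertex of $\mathcal{C}$ satisfies the NC property in $G$ and every hole of $G$ contains at most one vertex of $\mathcal{C}$. A graph $G$ satisfies the NC property if it has a hole cover satisfying the NC property in $G$. $\omega(G)$ is the clique number and $\chi_{DP}(G)$ is the DP-chromatic (correspondence chromatic) number of $G$. -}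

module Defs where

open import Data.Nat using (ℕ; zero; suc; _+_; _∸_; _≤_; _%_)
open import Data.Nat.DivMod using (m%n<n)
open import Data.Fin using (Fin; toℕ; fromℕ<)
open import Data.Fin.Subset using (Subset; _∈_; Nonempty)
open import Data.Bool using (Bool; true; false)
open import Data.Maybe using (Maybe; just)
open import Data.Product using (Σ; ∃; ∃-syntax; _×_; _,_)
open import Data.Sum using (_⊎_)
open import Relation.Nullary using (¬_)
open import Relation.Binary.PropositionalEquality using (_≡_; _≢_)

record Graph (N : ℕ) : Set where
  field
    adj   : Fin N → Fin N → Bool
    sym   : ∀ x y → adj x y ≡ adj y x
    irref : ∀ x → adj x x ≡ false

open Graph public

Adj : ∀ {N} → Graph N → Fin N → Fin N → Set
Adj G x y = adj G x y ≡ true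

next : ∀ {k} → Fin (suc k) → Fin (suc k)
next {k} i = fromℕ< (m%n<n (suc (toℕ i)) (suc k))

CycAdj : ∀ {k} → Fin (suc k) → Fin (suc k) → Set
CycAdj i j = (j ≡ next i) ⊎ (i ≡ next j)

record Hole {N : ℕ} (G : Graph N) : Set where
  field
    m      : ℕ
    vtx    : Fin (suc (suc (suc (suc m)))) → Fin N
    inj    : ∀ i j → vtx i ≡ vtx j → i ≡ j
    cycle  : ∀ i j → CycAdj i j → Adj G (vtx i) (vtx j)
    induced : ∀ i j → Adj G (vtx i) (vtx j) → CycAdj i j

open Hole public

_∈H_ : ∀ {N} {G : Graph N} → Fin N → Hole G → Set
u ∈H H = ∃[ i ] (vtx H i ≡ u)

HoleEdge : ∀ {N} {G : Graph N} → Hole G → Fin N → Fin N → Set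
HoleEdge H x y = ∃[ i ] ((vtx H i ≡ x × vtx H (next i) ≡ y) ⊎ (vtx H i ≡ y × vtx H (next i) ≡ x))

-- H and H' share two consecutive edges ab, bc (a ≠ c); two edges of a
-- cycle with a common end are consecutive on it.
ShareConsecutive : ∀ {N} {G : Graph N} → Hole G → Hole G → Set
ShareConsecutive {N} H H' =
  Σ (Fin N) λ a → Σ (Fin N) λ b → Σ (Fin N) λ c →
    a ≢ c × HoleEdge H a b × HoleEdge H b c × HoleEdge H' a b × HoleEdge H' b c

HoleCover : ∀ {N} → Graph N → Subset N → Set
HoleCover G X = Nonempty X × (∀ (H : Hole G) → ∃[ x ] (x ∈ X × x ∈H H))

VertexNC : ∀ {N} → Graph N → Fin N → Set
VertexNC G u = ∀ (H H' : Hole G) → u ∈H H → ¬ (u ∈H H') → ¬ ShareConsecutive H H'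

SetNC : ∀ {N} → Graph N → Subset N → Set
SetNC G C = (∀ u → u ∈ C → VertexNC G u)
          × (∀ (H : Hole G) (i j : Fin _) → vtx H i ∈ C → vtx H j ∈ C → vtx H i ≡ vtx H j)

NCGraph : ∀ {N} → Graph N → Set
NCGraph {N} G = Σ (Subset N) λ X → HoleCover G X × SetNC G X

HasClique : ∀ {N} → Graph N → ℕ → Set
HasClique {N} G k = Σ (Fin k → Fin N) λ f →
  (∀ i j → f i ≡ f j → i ≡ j) × (∀ i j → i ≢ j → Adj G (f i) (f j))

IsCliqueNumber : ∀ {N} → Graph N → ℕ → Set
IsCliqueNumber G w = HasClique G w × ¬ HasClique G (suc w)

-- DP (correspondence) colouring.  A k-fold cover assigns to every ordered
-- pair (u,v) a relation M u v ⊆ [k]×[k], symmetric (M u v i j = M v u j i)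
-- and a matching; it only matters on edges uv.
record Cover {N : ℕ} (G : Graph N) (k : ℕ) : Set where
  field
    M     : Fin N → Fin N → Fin k → Fin k → Bool
    symM  : ∀ u v i j → M u v i j ≡ M v u j i
    match₁ : ∀ u v i j j' → M u v i j ≡ true → M u v i j' ≡ true → j ≡ j'
    match₂ : ∀ u v i i' j → M u v i j ≡ true → M u v i' j ≡ true → i ≡ i'

open Cover public

DPColouring : ∀ {N k} {G : Graph N} → Cover G k → (Fin N → Fin k) → Set
DPColouring {G = G} 𝓗 f = ∀ u v → Adj G u v → M 𝓗 u v (f u) (f v) ≡ false

DPColourable : ∀ {N} → Graph N → ℕ → Set
DPColourable {N} G k = ∀ (𝓗 : Cover G k) → Σ (Fin N → Fin k) λ f → DPColouring 𝓗 f

-- χ_DP(G) ≤ m  (χ_DP is the least k with G DP-k-colourable)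
χDP≤ : ∀ {N} → Graph N → ℕ → Set
χDP≤ G m = ∃[ k ] (k ≤ m × DPColourable G k)

data WalkIn {N : ℕ} (G : Graph N) (P : Fin N → Set) : Fin N → Fin N → Set where
  here : ∀ {x} → P x → WalkIn G P x x
  step : ∀ {x y z} → P x → Adj G x y → WalkIn G P y z → WalkIn G P x z

-- G has a K_n minor: disjoint nonempty connected branch sets B_0 … B_{n-1}
-- (β x = just i means x ∈ B_i), pairwise joined by an edge.
HasKMinor : ∀ {N} → Graph N → ℕ → Set
HasKMinor {N} G n = Σ (Fin N → Maybe (Fin n)) λ β →
    (∀ i → ∃[ x ] (β x ≡ just i))
  × (∀ i x y → β x ≡ just i → β y ≡ just i → WalkIn G (λ z → β z ≡ just i) x y)
  × (∀ i j → i ≢ j → ∃[ x ] ∃[ y ] (β x ≡ just i × β y ≡ just j × Adj G x y))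

KMinorFree : ∀ {N} → Graph N → ℕ → Set
KMinorFree G n = ¬ HasKMinor G n

{-# OPTIONS --safe #-}
-- Join every vertex u of the hole cover to all vertices that lie on a common hole with u.
-- By the NC property u separates the two hole-neighbours of any b on a hole through u once the
-- closed neighbourhood of b is deleted, so joining u destroys all holes through u and creates
-- none; after all joins the graph is chordal.  Inside a clique of this chordal completion no two
-- new edges are disjoint, since they would give a hole with two vertices of the cover; hence all
-- new edges meet one vertex z, and deleting z leaves a clique of the original graph.  The
-- holes through z and the other clique vertices provide a branch set that replaces z, so a
-- clique of the completion also gives a complete minor of the same order.  Finally a chordal
-- graph without a clique of order k + 1 is greedily DP-k-colourable along simplicial vertices.
-- The search for a colouring is finite, so that existence may be proved under a double negation.

module Submission where

open import Defs
open import Data.Nat using (ℕ; zero; suc; _∸_; _≤_; _<_; z≤n; s≤s; _%_)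
import Data.Nat.Properties as ℕₚ
open import Data.Nat.DivMod using (m<n⇒m%n≡m; n%n≡0)
open import Data.Bool using (true; false; if_then_else_)
import Data.Bool.Properties as Boolₚ
open import Data.Fin using (Fin; zero; suc; toℕ; fromℕ; inject₁; punchIn; finToFun; funToFin)
import Data.Fin.Properties as Finₚ
open import Data.Fin.Properties using (_≟_; any?; all?; punchIn-injective; punchInᵢ≢i; finToFun-funToFin)
open import Data.Fin.Subset using (Subset; _⊂_; _-_; ⊤) renaming (_∈_ to _∈ˢ_)
open import Data.Fin.Subset.Properties using (x∈p∧x≢y⇒x∈p-y; x∈p⇒p-x⊂p; ∈⊤)
  renaming (_∈?_ to _∈ˢ?_; nonempty? to nonemptyˢ?)
open import Data.Fin.Subset.Induction using (⊂-wellFounded)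
open import Data.List using (List; []; _∷_; allFin)
open import Data.List.Membership.Propositional using () renaming (_∈_ to _∈ˡ_)
open import Data.List.Membership.Propositional.Properties using (∈-allFin)
open import Data.List.Relation.Unary.Any using (here; there)
open import Data.Maybe using (Maybe; just; nothing)
open import Data.Product using (Σ; ∃-syntax; _×_; _,_; proj₁; proj₂) renaming (swap to ×-swap)
open import Data.Sum using (_⊎_; inj₁; inj₂; [_,_]′; swap) renaming (map to ⊎-map)
open import Data.Empty using (⊥; ⊥-elim)
open import Data.Vec using (tabulate)
open import Data.Vec.Properties using (lookup∘tabulate; []=⇒lookup; lookup⇒[]=)
open import Function using (_∘_; id)
open import Function.Bundles using (mk⇔)
open import Induction.WellFounded using (Acc; acc)
open import Relation.Nullary using (¬_; Dec; yes; no; does)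
open import Relation.Nullary.Decidable
  using (¬¬-excluded-middle; decidable-stable; dec-true; dec-false; does-⇔; _⊎-dec_; _×-dec_; _→-dec_; ¬?)
open import Relation.Nullary.Negation using (contradiction)
open import Relation.Unary using (Decidable)
open import Relation.Binary.Definitions using (tri<; tri≈; tri>)
open import Relation.Binary.PropositionalEquality as ≡
  using (_≡_; _≢_; refl; cong; subst; subst₂)

private
  variable
    N : ℕ

-- Finite case distinctions and basic facts on adjacency.

witness : ∀ {A : Set} (d : Dec A) → does d ≡ true → A
witness (yes x) _ = x

-- Finitely many instances of excluded middle combine under one double negation. This makes
-- reachability and lying on a common hole decidable whenever the goal is a negation.
∀-dec : ∀ {n} (P : Fin n → Set) → ¬ ¬ (∀ i → Dec (P i))
∀-dec {zero} P k = k λ ()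
∀-dec {suc n} P k =
  ¬¬-excluded-middle λ d → ∀-dec (P ∘ suc) λ ds → k λ { zero → d ; (suc i) → ds i }

Adj-sym : (G : Graph N) → ∀ {x y} → Adj G x y → Adj G y x
Adj-sym G {x} {y} e = ≡.trans (sym G y x) e

Adj⇒≢ : (G : Graph N) → ∀ {x y} → Adj G x y → x ≢ y
Adj⇒≢ G {x} e refl with ≡.trans (≡.sym e) (irref G x)
... | ()

Adj? : (G : Graph N) → ∀ x y → Dec (Adj G x y)
Adj? G x y = adj G x y Boolₚ.≟ true

-- Walks and induced paths

module _ {G : Graph N} where

  private
    Walk : (Fin N → Set) → Fin N → Fin N → Set
    Walk = WalkIn G

  mapʷ : ∀ {P Q : Fin N → Set} {x y} → (∀ {z} → P z → Q z) → Walk P x y → Walk Q x y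
  mapʷ f (here p) = here (f p)
  mapʷ f (step p e w) = step (f p) e (mapʷ f w)

  source : ∀ {P x y} → Walk P x y → P x
  source (here p) = p
  source (step p _ _) = p

  infixr 5 _++ʷ_
  _++ʷ_ : ∀ {P x y z} → Walk P x y → Walk P y z → Walk P x z
  here _ ++ʷ v = v
  step p e w ++ʷ v = step p e (w ++ʷ v)

  snoc : ∀ {P x y z} → Walk P x y → Adj G y z → P z → Walk P x z
  snoc (here p) e q = step p e (here q)
  snoc (step p e w) f q = step p e (snoc w f q)

  reverseʷ : ∀ {P x y} → Walk P x y → Walk P y x
  reverseʷ (here p) = here p
  reverseʷ (step p e w) = snoc (reverseʷ w) (Adj-sym G e) p

  target : ∀ {P x y} → Walk P x y → P y
  target = source ∘ reverseʷ

  -- Places a walk inside the component of its end, so that membership in a component can be carried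
  -- along as the predicate of a walk.
  suffixes : ∀ {P x y} → Walk P x y → Walk (λ z → Walk P z y) x y
  suffixes (here p) = here (here p)
  suffixes (step p e w) = step (step p e w) e (suffixes w)

  prefixes : ∀ {P x y} → Walk P x y → Walk (λ z → Walk P x z) x y
  prefixes w = mapʷ reverseʷ (reverseʷ (suffixes (reverseʷ w)))

  firstHit : ∀ {P Q x y} → Decidable Q → Walk P x y → Q y →
    ∃[ z ] (Q z × Walk (λ t → P t × (t ≡ z ⊎ ¬ Q t)) x z)
  firstHit Q? (here p) q = _ , q , here (p , inj₁ refl)
  firstHit {x = x} Q? (step p e w) q with Q? x
  ... | yes qx = _ , qx , here (p , inj₁ refl)
  ... | no ¬qx = let z , qz , w' = firstHit Q? w q in z , qz , step (p , inj₂ ¬qx) e w'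

  lastHit : ∀ {P Q x y} → Decidable Q → Walk P x y → Q x →
    ∃[ z ] (Q z × Walk (λ t → P t × (t ≡ z ⊎ ¬ Q t)) z y)
  lastHit Q? w q = let z , qz , w' = firstHit Q? (reverseʷ w) q in z , qz , reverseʷ w'

  approach : ∀ {P x y} → Walk P x y → x ≢ y →
    ∃[ p ] (Adj G p y × Walk (λ t → P t × t ≢ y) x p)
  approach (here _) x≢y = contradiction refl x≢y
  approach {y = y} (step {y = x'} p e w) x≢y with x' ≟ y
  ... | yes refl = _ , e , here (p , x≢y)
  ... | no x'≢y = let q , f , w' = approach w x'≢y in q , f , step (p , x≢y) e w'

record InducedPath (G : Graph N) (P : Fin N → Set) (x z : Fin N) (n : ℕ) : Set where
  field
    p       : Fin (suc n) → Fin N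
    first   : p zero ≡ x
    last    : p (fromℕ n) ≡ z
    within  : ∀ i → P (p i)
    p-inj   : ∀ i j → p i ≡ p j → i ≡ j
    edge    : ∀ i j → toℕ j ≡ suc (toℕ i) → Adj G (p i) (p j)
    p-ind   : ∀ i j → toℕ i < toℕ j → Adj G (p i) (p j) → toℕ j ≡ suc (toℕ i)

open InducedPath

tailᵖ : ∀ {G : Graph N} {P x z n} (q : InducedPath G P x z (suc n)) → InducedPath G P (p q (suc zero)) z n
tailᵖ q = record
  { p = p q ∘ suc ; first = refl ; last = last q ; within = within q ∘ suc
  ; p-inj = λ i j e → Finₚ.suc-injective (p-inj q _ _ e)
  ; edge = λ i j e → edge q _ _ (cong suc e)
  ; p-ind = λ i j l e → ℕₚ.suc-injective (p-ind q _ _ (s≤s l) e) }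

rebase : ∀ {G : Graph N} {P x y z n} (q : InducedPath G P y z n) → x ≡ p q zero → InducedPath G P x z n
rebase q eq = record
  { p = p q ; first = ≡.sym eq ; last = last q ; within = within q
  ; p-inj = p-inj q ; edge = edge q ; p-ind = p-ind q }

prepend : ∀ (G : Graph N) {P x y z n} → P x → (q : InducedPath G P y z n) → Adj G x (p q zero) →
  (∀ i → 0 < toℕ i → ¬ (x ≡ p q i ⊎ Adj G x (p q i))) → InducedPath G P x z (suc n)
prepend {N} G {x = x} {n = n} px q e far = record
  { p = p' ; first = refl ; last = last q
  ; within = λ { zero → px ; (suc i) → within q i }
  ; p-inj = inj' ; edge = edge' ; p-ind = ind' }
  where
  p' : Fin (suc (suc n)) → Fin N
  p' zero = x
  p' (suc i) = p q i
  x∉ : ∀ i → x ≢ p q i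
  x∉ zero = Adj⇒≢ G e
  x∉ (suc i) eq = far (suc i) (s≤s z≤n) (inj₁ eq)
  inj' : ∀ i j → p' i ≡ p' j → i ≡ j
  inj' zero zero _ = refl
  inj' zero (suc j) eq = contradiction eq (x∉ j)
  inj' (suc i) zero eq = contradiction (≡.sym eq) (x∉ i)
  inj' (suc i) (suc j) eq = cong suc (p-inj q i j eq)
  edge' : ∀ i j → toℕ j ≡ suc (toℕ i) → Adj G (p' i) (p' j)
  edge' zero (suc zero) _ = e
  edge' (suc i) (suc j) eq = edge q i j (ℕₚ.suc-injective eq)
  ind' : ∀ i j → toℕ i < toℕ j → Adj G (p' i) (p' j) → toℕ j ≡ suc (toℕ i)
  ind' zero (suc zero) _ _ = refl
  ind' zero (suc (suc j)) _ f = contradiction (inj₂ f) (far (suc j) (s≤s z≤n))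
  ind' (suc i) (suc j) (s≤s l) f = cong suc (p-ind q i j l f)

-- Shortcut to the last vertex of the path that equals x or is adjacent to it.
pathOn : ∀ (G : Graph N) {P x y z n} → P x → (q : InducedPath G P y z n) →
  ∃[ i ] (x ≡ p q i ⊎ Adj G x (p q i)) → ∃[ n' ] InducedPath G P x z n'
pathOn G {n = zero} px q (zero , inj₁ refl) = _ , rebase q refl
pathOn G {n = zero} px q (zero , inj₂ e) = _ , prepend G px q e λ { zero () }
pathOn G {x = x} {n = suc n} px q touch
  with any? (λ (i : Fin (suc n)) → (x ≟ p q (suc i)) ⊎-dec Adj? G x (p q (suc i)))
... | yes t = pathOn G px (tailᵖ q) t
... | no ¬t with touch
...   | suc i , t = contradiction (i , t) ¬t
...   | zero , inj₁ refl = _ , rebase q refl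
...   | zero , inj₂ e = _ , prepend G px q e λ { zero () ; (suc i) _ t → ¬t (i , t) }

inducedPath : ∀ (G : Graph N) {P x z} → WalkIn G P x z → ∃[ n ] InducedPath G P x z n
inducedPath G {x = x} (here px) = 0 , record
  { p = λ _ → x ; first = refl ; last = refl ; within = λ _ → px
  ; p-inj = λ { zero zero _ → refl } ; edge = λ { zero zero () } ; p-ind = λ { zero zero () } }
inducedPath G (step px e w) =
  let n , q = inducedPath G w in pathOn G px q (zero , inj₂ (subst (Adj G _) (≡.sym (first q)) e))

-- Holes

suc⇒next : ∀ {k} {i j : Fin (suc k)} → toℕ j ≡ suc (toℕ i) → j ≡ next i
suc⇒next {k} {i} {j} eq = Finₚ.toℕ-injective (≡.trans eq (≡.sym (≡.trans (Finₚ.toℕ-fromℕ< _)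
  (m<n⇒m%n≡m (subst (_< suc k) eq (Finₚ.toℕ<n j))))))

next-last : ∀ k → next (fromℕ k) ≡ zero
next-last k = Finₚ.toℕ-injective (≡.trans (Finₚ.toℕ-fromℕ< _)
  (≡.trans (cong (λ t → suc t % suc k) (Finₚ.toℕ-fromℕ k)) (n%n≡0 (suc k))))

next-view : ∀ {k} (i : Fin (suc k)) → toℕ (next i) ≡ suc (toℕ i) ⊎ i ≡ fromℕ k
next-view {k} i with ℕₚ.m≤n⇒m<n∨m≡n (Finₚ.toℕ≤pred[n] i)
... | inj₁ i<k = inj₁ (≡.trans (Finₚ.toℕ-fromℕ< _) (m<n⇒m%n≡m (s≤s i<k)))
... | inj₂ i≡k = inj₂ (Finₚ.toℕ-injective (≡.trans i≡k (≡.sym (Finₚ.toℕ-fromℕ k))))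

HoleEdge-sym : ∀ {G : Graph N} (H : Hole G) {x y} → HoleEdge H x y → HoleEdge H y x
HoleEdge-sym H (i , e) = i , swap e

along : ∀ (G : Graph N) {n} (r : Fin (suc n) → Fin N) →
  (∀ i j → toℕ j ≡ suc (toℕ i) → Adj G (r i) (r j)) →
  ∀ j → WalkIn G (λ z → ∃[ i ] (toℕ i ≤ toℕ j × z ≡ r i)) (r zero) (r j)
along G r e zero = here (zero , z≤n , refl)
along G {suc n} r e (suc j) = step (zero , z≤n , refl) (e zero (suc zero) refl)
  (mapʷ (λ { (i , l , eq) → suc i , s≤s l , eq })
    (along G (r ∘ suc) (λ i j eq → e _ _ (cong suc eq)) j))

alongFrom : ∀ (G : Graph N) {n} (r : Fin (suc n) → Fin N) →
  (∀ i j → toℕ j ≡ suc (toℕ i) → Adj G (r i) (r j)) →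
  ∀ j → WalkIn G (λ z → ∃[ i ] (toℕ j ≤ toℕ i × z ≡ r i)) (r j) (r (fromℕ n))
alongFrom G {n} r e zero = mapʷ (λ { (i , _ , eq) → i , z≤n , eq }) (along G r e (fromℕ n))
alongFrom G {suc n} r e (suc j) = mapʷ (λ { (i , l , eq) → suc i , s≤s l , eq })
  (alongFrom G (r ∘ suc) (λ i j eq → e _ _ (cong suc eq)) j)

-- The final walk is the hole without its apex `b`; it remembers both that its vertices lie on the
-- hole and that they satisfy `R`.
HoleThrough : (G : Graph N) (R : Fin N → Set) (a b c : Fin N) → Hole G → Set
HoleThrough G R a b c H =
    (b ∈H H)
  × (∀ z → z ∈H H → z ≡ b ⊎ R z)
  × HoleEdge H a b × HoleEdge H b c
  × WalkIn G (λ z → z ∈H H × R z) a c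

-- An induced path from `a` to `c` inside `R` is closed up by `b`. No chord arises at `b`, because
-- `R` admits only `a` and `c` as neighbours of `b`. Paths with no edge or one edge are excluded by
-- `a≢c` and `a≁c`, so the cycle has at least four vertices.
extract : ∀ (G : Graph N) {R a b c} → Adj G a b → Adj G c b → a ≢ c → ¬ Adj G a c →
  (∀ z → R z → z ≢ b × (Adj G z b → z ≡ a ⊎ z ≡ c)) →
  WalkIn G R a c → Σ (Hole G) (HoleThrough G R a b c)
extract {N} G {R} {a} {b} {c} ab cb a≢c a≁c R⊆ w with inducedPath G w
... | 0 , q = contradiction (≡.trans (≡.sym (first q)) (last q)) a≢c
... | 1 , q = contradiction (subst₂ (Adj G) (first q) (last q) (edge q zero (suc zero) refl)) a≁c
... | suc (suc k) , q = H , (zero , refl) , inH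
    , (zero , inj₂ (refl , ≡.trans (cong v (≡.sym (suc⇒next {i = zero} refl))) (first q)))
    , (fromℕ (suc (suc (suc k))) , inj₂ (last q , cong v (next-last _)))
    , subst₂ (WalkIn G _) (first q) (last q) (mapʷ onPath (along G (p q) (edge q) (fromℕ _)))
  where
  K : ℕ
  K = suc (suc (suc k))
  v : Fin (suc K) → Fin N
  v zero = b
  v (suc i) = p q i
  v-inj : ∀ i j → v i ≡ v j → i ≡ j
  v-inj zero zero _ = refl
  v-inj zero (suc j) eq = contradiction (≡.sym eq) (proj₁ (R⊆ _ (within q j)))
  v-inj (suc i) zero eq = contradiction eq (proj₁ (R⊆ _ (within q i)))
  v-inj (suc i) (suc j) eq = cong suc (p-inj q i j eq)
  fwd : ∀ i → Adj G (v i) (v (next i))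
  fwd i with next-view i
  fwd zero | _ = subst (λ t → Adj G b (v t)) (suc⇒next {i = zero} {j = suc zero} refl)
    (Adj-sym G (subst (λ t → Adj G t b) (≡.sym (first q)) ab))
  fwd (suc i) | inj₁ eq with next (suc i)
  ... | suc j = edge q i j (ℕₚ.suc-injective eq)
  fwd (suc i) | inj₂ refl = subst₂ (Adj G) (≡.sym (last q)) (cong v (≡.sym (next-last K))) cb
  atb : ∀ i → Adj G (p q i) b → CycAdj zero (suc i)
  atb i e with proj₂ (R⊆ _ (within q i)) e
  ... | inj₁ eq = inj₁ (suc⇒next (cong (suc ∘ toℕ) (p-inj q i zero (≡.trans eq (≡.sym (first q))))))
  ... | inj₂ eq = inj₂ (≡.trans (≡.sym (next-last K))
          (cong (next ∘ suc) (≡.sym (p-inj q i (fromℕ _) (≡.trans eq (≡.sym (last q)))))))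
  v-ind : ∀ i j → Adj G (v i) (v j) → CycAdj i j
  v-ind zero zero e = contradiction refl (Adj⇒≢ G e)
  v-ind zero (suc j) e = atb j (Adj-sym G e)
  v-ind (suc i) zero e = swap (atb i e)
  v-ind (suc i) (suc j) e with ℕₚ.<-cmp (toℕ i) (toℕ j)
  ... | tri< l _ _ = inj₁ (suc⇒next (cong suc (p-ind q i j l e)))
  ... | tri≈ _ eq _ = contradiction (cong (p q) (Finₚ.toℕ-injective eq)) (Adj⇒≢ G e)
  ... | tri> _ _ g = inj₂ (suc⇒next (cong suc (p-ind q j i g (Adj-sym G e))))
  H : Hole G
  H = record
    { m = k ; vtx = v ; inj = v-inj
    ; cycle = λ { i j (inj₁ refl) → fwd i ; i j (inj₂ refl) → Adj-sym G (fwd j) }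
    ; induced = v-ind }
  inH : ∀ z → z ∈H H → z ≡ b ⊎ R z
  inH _ (zero , refl) = inj₁ refl
  inH _ (suc i , refl) = inj₂ (within q i)
  onPath : ∀ {z} → ∃[ i ] (toℕ i ≤ toℕ (fromℕ (suc (suc k))) × z ≡ p q i) → z ∈H H × R z
  onPath (i , _ , refl) = (suc i , refl) , within q i

-- Rotations of a hole and the two arcs at a vertex.

next-surj : ∀ {k} (i : Fin (suc k)) → ∃[ j ] (i ≡ next j)
next-surj {k} zero = fromℕ k , ≡.sym (next-last k)
next-surj {suc k} (suc i) = inject₁ i , suc⇒next (cong suc (≡.sym (Finₚ.toℕ-inject₁ i)))

next-inj : ∀ {k} (i j : Fin (suc k)) → next i ≡ next j → i ≡ j
next-inj {k} i j eq with next-view i | next-view j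
... | inj₁ p | inj₁ q = Finₚ.toℕ-injective (ℕₚ.suc-injective (≡.trans (≡.sym p) (≡.trans (cong toℕ eq) q)))
... | inj₁ p | inj₂ refl with ≡.trans (≡.sym p) (cong toℕ (≡.trans eq (next-last k)))
...   | ()
next-inj {k} i j eq | inj₂ refl | inj₁ q with ≡.trans (≡.sym q) (cong toℕ (≡.trans (≡.sym eq) (next-last k)))
...   | ()
next-inj {k} i j eq | inj₂ refl | inj₂ refl = refl

-- The two holes may belong to different graphs on the same vertices, as is needed to trace a hole
-- of the completion back to the original graph.
record _≈_ {G G' : Graph N} (H : Hole G) (H' : Hole G') : Set where
  field
    to   : ∀ {z} → z ∈H H → z ∈H H'
    from : ∀ {z} → z ∈H H' → z ∈H H
    edges : ∀ {x y} → HoleEdge H x y → HoleEdge H' x y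

open _≈_ public

≈-refl : {G : Graph N} {H : Hole G} → H ≈ H
≈-refl = record { to = id ; from = id ; edges = id }

≈-trans : {G₁ G₂ G₃ : Graph N} {H₁ : Hole G₁} {H₂ : Hole G₂} {H₃ : Hole G₃} →
  H₁ ≈ H₂ → H₂ ≈ H₃ → H₁ ≈ H₃
≈-trans e f = record { to = to f ∘ to e ; from = from e ∘ from f ; edges = edges f ∘ edges e }

rotate : {G : Graph N} (H : Hole G) → Σ (Hole G) (_≈ H)
rotate H = record
  { m = m H ; vtx = vtx H ∘ next ; inj = λ i j e → next-inj i j (inj H _ _ e)
  ; cycle = λ i j → cycle H _ _ ∘ ⊎-map (cong next) (cong next)
  ; induced = λ i j e → ⊎-map (next-inj _ _) (next-inj _ _) (induced H _ _ e) }
  , record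
  { to = λ { (i , e) → next i , e }
  ; from = λ { (i , e) → let j , eq = next-surj i in j , ≡.trans (cong (vtx H) (≡.sym eq)) e }
  ; edges = λ { (i , e) → next i , e } }

-- Each rotation lowers the index by one. The recursion runs on `n` because `inject₁ i` is not a
-- subterm of `suc i`.
rotateTo : {G : Graph N} (n : ℕ) (H : Hole G) (i : Fin (suc (suc (suc (suc (m H)))))) → toℕ i ≡ n →
  Σ (Hole G) λ H' → H' ≈ H × vtx H' zero ≡ vtx H i
rotateTo n H zero _ = H , ≈-refl , refl
rotateTo (suc n) H (suc i) eq =
  let H₁ , H₁≈H = rotate H
      H' , H'≈H₁ , e = rotateTo n H₁ (inject₁ i) (≡.trans (Finₚ.toℕ-inject₁ i) (ℕₚ.suc-injective eq))
  in H' , ≈-trans H'≈H₁ H₁≈H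
   , ≡.trans e (cong (vtx H) (≡.sym (suc⇒next (cong suc (≡.sym (Finₚ.toℕ-inject₁ i))))))

-- The hole seen from its vertex `b`: without `b` it is a path from `a` to `c`. The arc from one end
-- to any vertex `z` other than the opposite end meets the neighbourhood of `b` in its starting
-- point only.
record Around {G : Graph N} (H : Hole G) (b : Fin N) : Set where
  field
    a c     : Fin N
    ab      : Adj G a b
    cb      : Adj G c b
    a≢c     : a ≢ c
    a≁c     : ¬ Adj G a c
    a∈      : a ∈H H
    c∈      : c ∈H H
    eab     : HoleEdge H a b
    ebc     : HoleEdge H b c
    only    : ∀ {z} → z ∈H H → Adj G z b → z ≡ a ⊎ z ≡ c
    around  : WalkIn G (λ t → t ∈H H × t ≢ b) a c
    arcA    : ∀ {z} → z ∈H H → z ≢ b → z ≢ c →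
              WalkIn G (λ t → t ∈H H × t ≢ b × (Adj G t b → t ≡ a)) a z
    arcC    : ∀ {z} → z ∈H H → z ≢ b → z ≢ a →
              WalkIn G (λ t → t ∈H H × t ≢ b × (Adj G t b → t ≡ c)) c z

open Around public

reflect : {G : Graph N} {H : Hole G} {b : Fin N} → Around H b → Around H b
reflect {G = G} {H} A = record
  { a = c A ; c = a A ; ab = cb A ; cb = ab A ; a≢c = a≢c A ∘ ≡.sym ; a≁c = a≁c A ∘ Adj-sym G
  ; a∈ = c∈ A ; c∈ = a∈ A ; eab = HoleEdge-sym H (ebc A) ; ebc = HoleEdge-sym H (eab A)
  ; only = λ z∈ e → swap (only A z∈ e)
  ; around = reverseʷ (around A) ; arcA = arcC A ; arcC = arcA A }

aroundZero : {G : Graph N} (H : Hole G) → Around H (vtx H zero)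
aroundZero {G = G} H = record
  { a = r zero ; c = r (fromℕ _)
  ; ab = Adj-sym G (cycle H zero (suc zero) (inj₁ one))
  ; cb = cycle H (fromℕ _) zero (inj₁ (≡.sym (next-last _)))
  ; a≢c = λ e → absurd₁ (inj H _ _ e)
  ; a≁c = λ e → absurd₂ (induced H _ _ e)
  ; a∈ = suc zero , refl ; c∈ = fromℕ _ , refl
  ; eab = zero , inj₂ (refl , cong (vtx H) (≡.sym one))
  ; ebc = fromℕ _ , inj₂ (refl , cong (vtx H) (next-last _))
  ; only = λ { (i , refl) e → ends i e }
  ; around = mapʷ (λ { (i , _ , refl) → (suc i , refl) , off i }) (along G r r-edge (fromℕ _))
  ; arcA = λ { (zero , refl) z≢b _ → contradiction refl z≢b
             ; (suc j , refl) _ z≢c → mapʷ (beforeLast j z≢c) (along G r r-edge j) }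
  ; arcC = λ { (zero , refl) z≢b _ → contradiction refl z≢b
             ; (suc zero , refl) _ z≢a → contradiction refl z≢a
             ; (suc (suc j) , refl) _ z≢a → reverseʷ (mapʷ afterFirst (alongFrom G r r-edge (suc j))) } }
  where
  r : Fin (suc (suc (suc (m H)))) → Fin _
  r = vtx H ∘ suc
  one : suc zero ≡ next {suc (suc (suc (m H)))} zero
  one = suc⇒next refl
  absurd₁ : suc zero ≢ fromℕ (suc (suc (suc (m H))))
  absurd₁ ()
  -- The two neighbours of index zero are not consecutive, since a hole has at least four vertices.
  absurd₂ : ¬ CycAdj (suc zero) (fromℕ (suc (suc (suc (m H)))))
  absurd₂ (inj₁ e) with ≡.trans (suc⇒next {i = suc zero} {j = suc (suc zero)} refl) (≡.sym e)
  ... | ()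
  absurd₂ (inj₂ e) with ≡.trans e (next-last _)
  ... | ()
  r-edge : ∀ i j → toℕ j ≡ suc (toℕ i) → Adj G (r i) (r j)
  r-edge i j e = cycle H _ _ (inj₁ (suc⇒next (cong suc e)))
  off : ∀ i → r i ≢ vtx H zero
  off i e with inj H _ _ e
  ... | ()
  ends : ∀ i → Adj G (vtx H i) (vtx H zero) → vtx H i ≡ r zero ⊎ vtx H i ≡ r (fromℕ _)
  ends i e with induced H _ _ e
  ... | inj₁ eq = inj₂ (cong (vtx H) (next-inj _ _ (≡.trans (≡.sym eq) (≡.sym (next-last _)))))
  ... | inj₂ eq = inj₁ (cong (vtx H) (≡.trans eq (≡.sym one)))
  beforeLast : ∀ j {z} → r j ≢ r (fromℕ _) → ∃[ i ] (toℕ i ≤ toℕ j × z ≡ r i) →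
    z ∈H H × z ≢ vtx H zero × (Adj G z (vtx H zero) → z ≡ r zero)
  beforeLast j ne (i , le , refl) = (suc i , refl) , off i , λ e →
    [ id , (λ eq → contradiction (cong r (Finₚ.toℕ-injective (ℕₚ.≤-antisym (Finₚ.≤fromℕ j)
      (subst (λ t → toℕ t ≤ toℕ j) (Finₚ.suc-injective (inj H _ _ eq)) le)))) ne) ]′ (ends (suc i) e)
  afterFirst : ∀ {j z} → ∃[ i ] (toℕ (suc j) ≤ toℕ i × z ≡ r i) →
    z ∈H H × z ≢ vtx H zero × (Adj G z (vtx H zero) → z ≡ r (fromℕ _))
  afterFirst (suc i , _ , refl) = (suc (suc i) , refl) , off (suc i) , λ e →
    [ (λ eq → contradiction (inj H _ _ eq) λ ()) , id ]′ (ends (suc (suc i)) e)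

around-≈ : {G : Graph N} {H' H : Hole G} {b : Fin N} → H' ≈ H → Around H' b → Around H b
around-≈ {G = G} eq A = record
  { a = a A ; c = c A ; ab = ab A ; cb = cb A ; a≢c = a≢c A ; a≁c = a≁c A
  ; a∈ = to eq (a∈ A) ; c∈ = to eq (c∈ A) ; eab = edges eq (eab A) ; ebc = edges eq (ebc A)
  ; only = only A ∘ from eq
  ; around = mapʷ (λ { (p , q) → to eq p , q }) (around A)
  ; arcA = λ z∈ n₁ n₂ → mapʷ (λ { (p , q) → to eq p , q }) (arcA A (from eq z∈) n₁ n₂)
  ; arcC = λ z∈ n₁ n₂ → mapʷ (λ { (p , q) → to eq p , q }) (arcC A (from eq z∈) n₁ n₂) }

aroundVertex : {G : Graph N} (H : Hole G) {b : Fin N} → b ∈H H → Around H b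
aroundVertex H (i , refl) =
  let H' , eq , e = rotateTo (toℕ i) H i refl in around-≈ eq (subst (Around H') e (aroundZero H'))

-- Vertices with the NC property

CommonHole : (G : Graph N) → Fin N → Fin N → Set
CommonHole G u w = Σ (Hole G) λ H → u ∈H H × w ∈H H

CommonHole-sym : {G : Graph N} {u w : Fin N} → CommonHole G u w → CommonHole G w u
CommonHole-sym (H , u∈ , w∈) = H , w∈ , u∈

-- A walk that misses u would close a hole without u sharing the edges at b with H.
separated : ∀ (G : Graph N) {u b} → VertexNC G u → (H : Hole G) → u ∈H H → (A : Around H b) → u ≢ b →
  ¬ WalkIn G (λ t → t ≢ u × t ≢ b × (Adj G t b → t ≡ a A ⊎ t ≡ c A)) (a A) (c A)
separated G {u} {b} nc H u∈ A u≢b w =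
  let H' , _ , inH' , e₁ , e₂ , _ = extract G (ab A) (cb A) (a≢c A) (a≁c A) (λ _ → proj₂) w
      u∉ = λ u∈' → [ u≢b , (λ r → proj₁ r refl) ]′ (inH' u u∈')
  in nc H H' u∈ u∉ (a A , b , c A , a≢c A , eab A , ebc A , e₁ , e₂)

module NCVertex (G : Graph N) (u : Fin N) (nc : VertexNC G u) where

  Near : Fin N → Fin N → Set
  Near b y = y ≡ b ⊎ Adj G y b

  near? : ∀ b → Decidable (Near b)
  near? b y = (y ≟ b) ⊎-dec Adj? G y b

  toCentre : ∀ {P : Fin N → Set} {b y} → P y → P b → Near b y → WalkIn G P y b
  toCentre py pb (inj₁ refl) = here py
  toCentre py pb (inj₂ e) = step py e (here pb)

  -- If b met both arcs of the hole from x to u, it would connect the neighbours of x without u.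
  avoid : ∀ {b x} → ¬ Near b u → ¬ Near b x → ¬ Adj G x u → CommonHole G u x →
    WalkIn G (λ t → ¬ Near b t) x u
  avoid {b} {x} b≁u b≁x x≁u (H , u∈ , x∈) with x ≟ u
  ... | yes refl = here b≁u
  ... | no x≢u = result
    where
    A = aroundVertex H x∈
    u≢x = x≢u ∘ ≡.sym
    Q : Fin N → Set
    Q z = z ≡ u ⊎ Near b z
    Q? : Decidable Q
    Q? z = (z ≟ u) ⊎-dec near? b z
    b≢x : b ≢ x
    b≢x e = b≁x (inj₁ (≡.sym e))
    b≢u : b ≢ u
    b≢u e = b≁u (inj₁ (≡.sym e))
    free : ∀ {t z} → z ≡ u → t ≡ z ⊎ ¬ Q t → ¬ Near b t
    free refl (inj₁ refl) = b≁u
    free _ (inj₂ ¬q) = ¬q ∘ inj₂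
    clear : ∀ {t z} → Near b z → t ≡ z ⊎ ¬ Q t → t ≢ u
    clear nz (inj₁ refl) refl = b≁u nz
    clear nz (inj₂ ¬q) = ¬q ∘ inj₁
    result : WalkIn G (λ t → ¬ Near b t) x u
    result with firstHit Q? (arcA A u∈ u≢x (λ { refl → x≁u (Adj-sym G (cb A)) })) (inj₁ refl)
              | firstHit Q? (arcC A u∈ u≢x (λ { refl → x≁u (Adj-sym G (ab A)) })) (inj₁ refl)
    -- This arc reaches `u` before it meets the closed neighbourhood of `b`, so it is the walk
    -- sought.
    ... | y , inj₁ refl , w₁ | _ = step b≁x (Adj-sym G (ab A)) (mapʷ (free refl ∘ proj₂) w₁)
    ... | y , inj₂ ny , w₁ | z , inj₁ refl , w₂ = step b≁x (Adj-sym G (cb A)) (mapʷ (free refl ∘ proj₂) w₂)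
    ... | y , inj₂ ny , w₁ | z , inj₂ nz , w₂ =
      ⊥-elim (separated G nc H u∈ A u≢x (w₁' ++ʷ yb ++ʷ reverseʷ zb ++ʷ reverseʷ w₂'))
      where
      P : Fin N → Set
      P t = t ≢ u × t ≢ x × (Adj G t x → t ≡ a A ⊎ t ≡ c A)
      w₁' = mapʷ {Q = P} (λ { ((_ , n , f) , h) → clear ny h , n , inj₁ ∘ f }) w₁
      w₂' = mapʷ {Q = P} (λ { ((_ , n , f) , h) → clear nz h , n , inj₂ ∘ f }) w₂
      Pb : P b
      Pb = b≢u , b≢x , λ e → contradiction (inj₂ (Adj-sym G e)) b≁x
      yb = toCentre (target w₁') Pb ny
      zb = toCentre (target w₂') Pb nz

  -- Deleting the closed neighbourhood of b and u splits the hole into a side at a and a side at c;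
  -- if v itself misses a, its own walk to u enters the side at a on a hole through a, b and v.
  side : ∀ {b v} (H : Hole G) → u ∈H H → (A : Around H b) → ¬ Near b u → Adj G v b →
    ¬ Adj G v u → ¬ CommonHole G u v →
    WalkIn G (λ t → t ≡ v ⊎ ¬ Near b t) v u →
    let S = λ (t : Fin N) → t ≢ u × (t ≡ a A ⊎ ¬ Near b t) in
    ∃[ y ] (Adj G y v × WalkIn G (λ t → (WalkIn G S (a A) t ⊎ t ≡ u) × (Adj G t v → t ≡ y)) y u)
  side {b} {v} H u∈ A b≁u vb v≁u v∉ Q = result
    where
    S W : Fin N → Set
    S t = t ≢ u × (t ≡ a A ⊎ ¬ Near b t)
    W t = WalkIn G (λ t → t ≡ a A ⊎ ¬ Near b t) t u
    u≢b : u ≢ b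
    u≢b = b≁u ∘ inj₁
    v≢a : v ≢ a A
    v≢a refl = v∉ (H , u∈ , a∈ A)
    u≢c : u ≢ c A
    u≢c refl = b≁u (inj₂ (cb A))
    u≢a : u ≢ a A
    u≢a refl = b≁u (inj₂ (ab A))
    fromArc : WalkIn G (λ t → t ≡ a A ⊎ ¬ Near b t) (a A) u
    fromArc = mapʷ outside (arcA A u∈ u≢b u≢c)
      where
      outside : ∀ {t} → t ∈H H × t ≢ b × (Adj G t b → t ≡ a A) → t ≡ a A ⊎ ¬ Near b t
      outside {t} (_ , t≢b , f) with Adj? G t b
      ... | yes e = inj₁ (f e)
      ... | no ¬e = inj₂ [ t≢b , ¬e ]′
    sided : ∀ {q} → WalkIn G S (a A) q → W q → WalkIn G (λ t → WalkIn G S (a A) t ⊎ t ≡ u) q u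
    sided {q} wq w =
      let y , e , w' = approach w (proj₁ (target wq))
          w'' = mapʷ (wq ++ʷ_) (prefixes (mapʷ ×-swap w'))
      in snoc (mapʷ inj₁ w'') e (inj₂ refl)
    start : ∃[ q ] (Adj G q v × WalkIn G S (a A) q × W q)
    start with Adj? G (a A) v
    ... | yes e = a A , e , here (u≢a ∘ ≡.sym , inj₁ refl) , fromArc
    ... | no a≁v = start'
      where
      -- Among `v` and the vertices of `W`, only `a A` and `v` are adjacent to `b`, so any walk
      -- within `R` between these two closes up with `b` to a hole.
      R : Fin N → Set
      R t = (t ≡ v ⊎ W t) × t ≢ b × (Adj G t b → t ≡ a A ⊎ t ≡ v)
      W⊆R : ∀ {t} → W t → R t
      W⊆R w with source w
      ... | inj₁ refl = inj₂ w , Adj⇒≢ G (ab A) , λ _ → inj₁ refl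
      ... | inj₂ n = inj₂ w , n ∘ inj₁ , λ e → contradiction (inj₂ e) n
      inW : ∀ {t} → (t ≡ v ⊎ W t) × t ≢ v → W t
      inW (inj₁ e , n) = contradiction e n
      inW (inj₂ w , _) = w
      start' : ∃[ q ] (Adj G q v × WalkIn G S (a A) q × W q)
      start' =
        let p , pv , Q' = approach (reverseʷ Q) (λ { refl → b≁u (inj₂ vb) })
            Q'' = mapʷ (λ { (inj₁ e , n) → contradiction e n ; (inj₂ n , _) → n }) Q'
            u⇝p = reverseʷ (mapʷ (W⊆R ∘ mapʷ inj₂) (suffixes (reverseʷ Q'')))
            a⇝u = mapʷ W⊆R (suffixes fromArc)
            a⇝v = snoc (a⇝u ++ʷ u⇝p) pv (inj₁ refl , Adj⇒≢ G vb , λ _ → inj₂ refl)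
            -- This hole contains `v` and therefore misses `u`; the vertex before `v` on it lies on
            -- the side of `a A`.
            H' , _ , _ , _ , _ , w = extract G (ab A) vb (v≢a ∘ ≡.sym) a≁v (λ _ → proj₂) a⇝v
            u∉ = λ u∈' → v∉ (H' , u∈' , proj₁ (target w))
            q , qv , w' = approach w (v≢a ∘ ≡.sym)
        in q , qv
         , mapʷ (λ { ((t∈ , r , _) , n) → (λ { refl → u∉ t∈ }) , source (inW (r , n)) }) w'
         , let (_ , r , _) , n = target w' in inW (r , n)
    result : _
    result with start
    -- Starting from the last neighbour of `v` ensures that the rest of the walk to `u` does not
    -- touch `v` again.
    ... | q , qv , wq , w with lastHit (λ t → Adj? G t v) (sided wq w) qv
    ... | y , yv , w' = y , yv , mapʷ (λ { (s , inj₁ refl) → s , λ _ → refl ; (s , inj₂ ¬e) → s , λ e → contradiction e ¬e }) w'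

  -- Through its neighbours on the two sides v lies on a hole, which must contain u, since nothing
  -- else joins the sides.
  noEscape : ∀ {b v} (H : Hole G) → u ∈H H → b ∈H H → ¬ Near b u → Adj G v b →
    ¬ Adj G v u → ¬ CommonHole G u v → ¬ WalkIn G (λ t → t ≡ v ⊎ ¬ Near b t) v u
  noEscape {b} {v} H u∈ b∈ b≁u vb v≁u v∉ Q = conclude
    where
    A = aroundVertex H b∈
    P S : Fin N → Set
    P t = t ≢ u × t ≢ b × (Adj G t b → t ≡ a A ⊎ t ≡ c A)
    S t = P t ⊎ t ≡ u
    cut : ¬ WalkIn G P (a A) (c A)
    cut = separated G nc H u∈ A (b≁u ∘ inj₁)
    fromA : ∀ {t} → t ≢ u × (t ≡ a A ⊎ ¬ Near b t) → P t
    fromA (t≢u , inj₁ refl) = t≢u , Adj⇒≢ G (ab A) , λ _ → inj₁ refl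
    fromA (t≢u , inj₂ n) = t≢u , n ∘ inj₁ , λ e → contradiction (inj₂ e) n
    fromC : ∀ {t} → t ≢ u × (t ≡ c A ⊎ ¬ Near b t) → P t
    fromC (t≢u , inj₁ refl) = t≢u , Adj⇒≢ G (cb A) , λ _ → inj₂ refl
    fromC (t≢u , inj₂ n) = t≢u , n ∘ inj₁ , λ e → contradiction (inj₂ e) n
    -- As a neighbour of `b`, the vertex `v` could satisfy `P` only as `a A` or `c A`, and both of
    -- these share the hole `H` with `u`.
    S⇒≢v : ∀ {t} → S t → t ≢ v
    S⇒≢v (inj₁ (_ , _ , f)) refl =
      [ (λ { refl → v∉ (H , u∈ , a∈ A) }) , (λ { refl → v∉ (H , u∈ , c∈ A) }) ]′ (f vb)
    S⇒≢v (inj₂ refl) refl = b≁u (inj₂ vb)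
    sided : ∀ {X t} → Adj G t v → X ⊎ t ≡ u → X
    sided e (inj₁ x) = x
    sided e (inj₂ refl) = contradiction (Adj-sym G e) v≁u
    conclude : ⊥
    conclude with side H u∈ A b≁u vb v≁u v∉ Q | side H u∈ (reflect A) b≁u vb v≁u v∉ Q
    ... | y , yv , wy | z , zv , wz = final
      where
      R : Fin N → Set
      R t = S t × t ≢ v × (Adj G t v → t ≡ y ⊎ t ≡ z)
      a⇝y : WalkIn G P (a A) y
      a⇝y = mapʷ fromA (sided yv (proj₁ (source wy)))
      c⇝z : WalkIn G P (c A) z
      c⇝z = mapʷ fromC (sided zv (proj₁ (source wz)))
      join : WalkIn G P y z → ⊥
      join w = cut (a⇝y ++ʷ w ++ʷ reverseʷ c⇝z)
      y⇝u : WalkIn G R y u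
      y⇝u = mapʷ (λ { (s , f) → let s' = ⊎-map (target ∘ mapʷ fromA) id s in s' , S⇒≢v s' , inj₁ ∘ f }) wy
      z⇝u : WalkIn G R z u
      z⇝u = mapʷ (λ { (s , f) → let s' = ⊎-map (target ∘ mapʷ fromC) id s in s' , S⇒≢v s' , inj₂ ∘ f }) wz
      final : ⊥
      final with extract G yv zv
        (λ { refl → join (here (target a⇝y)) })
        (λ e → join (step (target a⇝y) e (here (target c⇝z))))
        (λ _ → proj₂) (y⇝u ++ʷ reverseʷ z⇝u)
      ... | H' , v∈' , _ , _ , _ , w = join (mapʷ avoidsU w)
        where
        avoidsU : ∀ {t} → t ∈H H' × R t → P t
        avoidsU (t∈ , inj₁ pt , _) = pt
        avoidsU (t∈ , inj₂ refl , _) = contradiction (H' , t∈ , v∈') v∉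

-- Local chordalisation

relationGraph : (E : Fin N → Fin N → Set) → (∀ x y → Dec (E x y)) →
  (∀ {x y} → E x y → E y x) → (∀ {x} → ¬ E x x) →
  Σ (Graph N) λ G → (∀ {x y} → Adj G x y → E x y) × (∀ {x y} → E x y → Adj G x y)
relationGraph E E? E-sym E-irrefl = record
  { adj = λ x y → does (E? x y)
  ; sym = λ x y → does-⇔ (mk⇔ E-sym E-sym) (E? x y) (E? y x)
  ; irref = λ x → dec-false (E? x x) E-irrefl }
  , (λ {x} {y} e → witness (E? x y) e) , (λ {x} {y} e → dec-true (E? x y) e)

LocallyChordalised : (G : Graph N) (u : Fin N) → Fin N → Fin N → Set
LocallyChordalised G u x y =
  Adj G x y ⊎ (x ≢ y × (x ≡ u × CommonHole G u y ⊎ y ≡ u × CommonHole G u x))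

module LocalChordalisation (G : Graph N) (u : Fin N) (nc : VertexNC G u)
  (G' : Graph N)
  (sound : ∀ {x y} → Adj G' x y → LocallyChordalised G u x y)
  (complete : ∀ {x y} → LocallyChordalised G u x y → Adj G' x y) where

  open NCVertex G u nc

  -- Suppose the hole used a new edge from `b` to `u`. The other hole-neighbour `v` of `b` is then
  -- not joined to `u`, and the rest of the hole leads from `v` to `u`. Rerouting its new edges in
  -- `G` by `avoid` gives a walk that `noEscape` forbids.
  oldNeighbours : (H' : Hole G') → u ∈H H' → (b : Fin N) → b ∈H H' → Adj G' b u → Adj G b u
  oldNeighbours H' u∈ b b∈ bu with Adj? G b u
  ... | yes e = e
  ... | no b≁u = ⊥-elim ([ (λ u≡a → bad (reflect A) u≡a) , bad A ]′ (only A u∈ (Adj-sym G' bu)))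
    where
    A = aroundVertex H' b∈
    common : CommonHole G u b
    common with sound bu
    ... | inj₁ e = contradiction e b≁u
    ... | inj₂ (b≢u , inj₁ (b≡u , _)) = contradiction b≡u b≢u
    ... | inj₂ (_ , inj₂ (_ , h)) = h
    b≢u : b ≢ u
    b≢u = Adj⇒≢ G' bu
    b≁u' : ¬ Near b u
    b≁u' (inj₁ e) = b≢u (≡.sym e)
    b≁u' (inj₂ e) = b≁u (Adj-sym G e)
    bad : (A : Around H' b) → u ≡ c A → ⊥
    bad A refl = let H , u∈H , b∈H = common in
      noEscape H u∈H b∈H b≁u' vb v≁u v∉ (descend (mapʷ (λ { (t∈ , t≢b) → t≢b , only A t∈ }) (around A)))
      where
      v = a A
      vb : Adj G v b
      vb with sound (ab A)
      ... | inj₁ e = e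
      ... | inj₂ (_ , inj₁ (v≡u , _)) = contradiction v≡u (a≢c A)
      ... | inj₂ (_ , inj₂ (b≡u , _)) = contradiction b≡u b≢u
      v≁u : ¬ Adj G v u
      v≁u e = a≁c A (complete (inj₁ e))
      v∉ : ¬ CommonHole G u v
      v∉ h = a≁c A (complete (inj₂ (a≢c A , inj₂ (refl , h))))
      good : ∀ {t} → t ≢ b × (Adj G' t b → t ≡ v ⊎ t ≡ u) → t ≡ v ⊎ ¬ Near b t
      good {t} (t≢b , f) with Adj? G t b
      ... | no t≁b = inj₂ [ t≢b , t≁b ]′
      ... | yes e with f (complete (inj₁ e))
      ...   | inj₁ t≡v = inj₁ t≡v
      ...   | inj₂ refl = contradiction (Adj-sym G e) b≁u
      -- Every new edge has `u` as an end: the walk stops once it is at `u`, and a new edge into `u`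
      -- is replaced by a walk from `avoid`.
      descend : ∀ {x} → WalkIn G' (λ t → t ≢ b × (Adj G' t b → t ≡ v ⊎ t ≡ u)) x u →
        WalkIn G (λ t → t ≡ v ⊎ ¬ Near b t) x u
      descend (here p) = here (good p)
      descend {x} (step p e w) with sound e
      ... | inj₁ e' = step (good p) e' (descend w)
      ... | inj₂ (_ , inj₁ (refl , _)) = here (good p)
      ... | inj₂ (_ , inj₂ (refl , h)) with good p | Adj? G x u
      ...   | _ | yes xu = step (good p) xu (here (inj₂ b≁u'))
      ...   | inj₁ refl | _ = contradiction h v∉
      ...   | inj₂ b≁x | no x≁u = mapʷ inj₂ (avoid b≁u' b≁x x≁u h)

  oldHoleIf : (H' : Hole G') → (∀ {x y} → x ∈H H' → y ∈H H' → Adj G' x y → Adj G x y) →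
    Σ (Hole G) (H' ≈_)
  oldHoleIf H' old = record
    { m = m H' ; vtx = vtx H' ; inj = inj H'
    ; cycle = λ i j e → old (i , refl) (j , refl) (cycle H' i j e)
    ; induced = λ i j e → induced H' i j (complete (inj₁ e)) }
    , record { to = id ; from = id ; edges = id }

  -- All edges of such a hole are old, so it is a hole of `G` through `u`, and `u` has been joined
  -- to all of its vertices. The vertex after `a A` on the way to `c A` then gives a chord at `u`.
  noHoleThroughCentre : (H' : Hole G') → ¬ u ∈H H'
  noHoleThroughCentre H' u∈ = second (around A) refl refl
    where
    A = aroundVertex H' u∈
    old : ∀ {x y} → x ∈H H' → y ∈H H' → Adj G' x y → Adj G x y
    old x∈ y∈ e with sound e
    ... | inj₁ e' = e'
    ... | inj₂ (_ , inj₁ (refl , _)) = Adj-sym G (oldNeighbours H' u∈ _ y∈ (Adj-sym G' e))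
    ... | inj₂ (_ , inj₂ (refl , _)) = oldNeighbours H' u∈ _ x∈ e
    second : ∀ {x z} → WalkIn G' (λ t → t ∈H H' × t ≢ u) x z → x ≡ a A → z ≡ c A → ⊥
    second (here _) x≡a x≡c = a≢c A (≡.trans (≡.sym x≡a) x≡c)
    second (step _ e w) refl refl =
      let y∈ , y≢u = source w
          H , eq = oldHoleIf H' old
          yu = complete (inj₂ (y≢u , inj₂ (refl , H , to eq u∈ , to eq y∈)))
      in [ (λ y≡a → Adj⇒≢ G' e (≡.sym y≡a)) , (λ { refl → a≁c A e }) ]′ (only A y∈ yu)

  -- New edges all meet `u`, and no hole of `G'` passes through `u`.
  oldHole : (H' : Hole G') → Σ (Hole G) (H' ≈_)
  oldHole H' = oldHoleIf H' old
    where
    old : ∀ {x y} → x ∈H H' → y ∈H H' → Adj G' x y → Adj G x y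
    old x∈ y∈ e with sound e
    ... | inj₁ e' = e'
    ... | inj₂ (_ , inj₁ (refl , _)) = contradiction x∈ (noHoleThroughCentre H')
    ... | inj₂ (_ , inj₂ (refl , _)) = contradiction y∈ (noHoleThroughCentre H')

-- The completion obtained by treating the cover vertices one after another.

-- Joining creates no hole, so the NC property of the vertices still to be treated survives every
-- stage.
VertexNC-≈ : {G G' : Graph N} {u : Fin N} → (∀ H' → Σ (Hole G) (_≈_ {G = G'} H')) →
  VertexNC G u → VertexNC G' u
VertexNC-≈ old nc H₁ H₂ u∈ u∉ (x , y , z , x≢z , e₁ , e₂ , f₁ , f₂) =
  let K₁ , eq₁ = old H₁ ; K₂ , eq₂ = old H₂
  in nc K₁ K₂ (to eq₁ u∈) (u∉ ∘ from eq₂)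
       (x , y , z , x≢z , edges eq₁ e₁ , edges eq₁ e₂ , edges eq₂ f₁ , edges eq₂ f₂)

Chord : Graph N → Subset N → Fin N → Fin N → Set
Chord G X x y = x ∈ˢ X × x ≢ y × CommonHole G x y

-- `us` lists the vertices already treated. New edges are justified by holes of the original `G`,
-- not of an intermediate graph, so that the hypotheses on `G` apply to them directly.
record Completion (G : Graph N) (X : Subset N) (us : List (Fin N)) : Set where
  field
    graph   : Graph N
    extends : ∀ {x y} → Adj G x y → Adj graph x y
    added   : ∀ {x y} → Adj graph x y → Adj G x y ⊎ (Chord G X x y ⊎ Chord G X y x)
    oldHole : (H : Hole graph) → Σ (Hole G) (H ≈_)
    avoids  : ∀ (H : Hole graph) {u} → u ∈ˡ us → u ∈ˢ X → ¬ u ∈H H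

open Completion public

completion : (G : Graph N) (X : Subset N) → (∀ u → u ∈ˢ X → VertexNC G u) →
  ∀ us → ¬ ¬ Completion G X us
completion G X nc [] k = k record
  { graph = G ; extends = id ; added = inj₁ ; oldHole = λ H → H , ≈-refl ; avoids = λ _ () }
completion {N} G X nc (u ∷ us) k = completion G X nc us extend
  where
  extend : ¬ Completion G X us
  extend K with u ∈ˢ? X
  ... | no u∉X = k record
    { graph = graph K ; extends = extends K ; added = added K ; oldHole = oldHole K
    ; avoids = λ { H (here refl) u∈X → contradiction u∈X u∉X ; H (there v∈) → avoids K H v∈ } }
  ... | yes u∈X = ∀-dec (CommonHole (graph K) u) λ hole? →
    let E? = λ x y → Adj? (graph K) x y ⊎-dec (¬? (x ≟ y) ×-dec
               (((x ≟ u) ×-dec hole? y) ⊎-dec ((y ≟ u) ×-dec hole? x)))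
        G' , sound , complete = relationGraph (LocallyChordalised (graph K) u) E? E-sym
          [ (λ e → Adj⇒≢ (graph K) e refl) , (λ p → proj₁ p refl) ]′
        open LocalChordalisation (graph K) u (VertexNC-≈ (oldHole K) (nc u u∈X)) G' sound complete
          using (noHoleThroughCentre) renaming (oldHole to older)
    in k record
      { graph = G'
      ; extends = complete ∘ inj₁ ∘ extends K
      ; added = λ e → addedTo (sound e)
      ; oldHole = λ H → let H' , eq = older H ; H'' , eq' = oldHole K H' in H'' , ≈-trans eq eq'
      ; avoids = λ { H (here refl) _ → noHoleThroughCentre H
                   ; H (there v∈) v∈X v∈H → let H' , eq = older H in avoids K H' v∈ v∈X (to eq v∈H) } }
    where
    E-sym : ∀ {x y} → LocallyChordalised (graph K) u x y → LocallyChordalised (graph K) u y x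
    E-sym (inj₁ e) = inj₁ (Adj-sym (graph K) e)
    E-sym (inj₂ (ne , p)) = inj₂ (ne ∘ ≡.sym , swap p)
    lift : ∀ {x} → CommonHole (graph K) u x → CommonHole G u x
    lift (H , u∈ , x∈) = let H' , eq = oldHole K H in H' , to eq u∈ , to eq x∈
    addedTo : ∀ {x y} → LocallyChordalised (graph K) u x y → Adj G x y ⊎ (Chord G X x y ⊎ Chord G X y x)
    addedTo (inj₁ e) = added K e
    addedTo (inj₂ (ne , inj₁ (refl , h))) = inj₂ (inj₁ (u∈X , ne , lift h))
    addedTo (inj₂ (ne , inj₂ (refl , h))) = inj₂ (inj₂ (u∈X , ne ∘ ≡.sym , lift h))

-- A hole of the completion is a hole of `G`, so the cover meets it; but every cover vertex has been
-- treated and lies on no remaining hole.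
completion-chordal : {G : Graph N} {X : Subset N} → HoleCover G X →
  (K : Completion G X (allFin N)) → ¬ Hole (graph K)
completion-chordal (_ , cover) K H =
  let H' , eq = oldHole K H ; x , x∈X , x∈H' = cover H'
  in avoids K H (∈-allFin x) x∈X (from eq x∈H')

-- Cliques of the completion

module NCSet (G : Graph N) (X : Subset N) (ncX : SetNC G X) where

  inX-unique : (H : Hole G) → ∀ {x y} → x ∈ˢ X → y ∈ˢ X → x ∈H H → y ∈H H → x ≡ y
  inX-unique H x∈X y∈X (i , refl) (j , refl) = proj₂ ncX H i j x∈X y∈X

  Apart : Fin N → Fin N → Fin N → Set
  Apart u₁ u₂ t = t ≢ u₁ × t ≢ u₂ × ¬ (Adj G t u₁ × Adj G t u₂)

  -- Otherwise the edge u₁u₂ would close a hole containing two vertices of X.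
  noDetour : ∀ {u₁ u₂ q y} → u₁ ∈ˢ X → u₂ ∈ˢ X → Adj G u₁ u₂ →
    Adj G q u₂ → Adj G y u₁ → ¬ WalkIn G (Apart u₁ u₂) q y
  noDetour {u₁} {u₂} u₁∈ u₂∈ e qu₂ yu₁ w with firstHit (λ t → Adj? G t u₁) w yu₁
  ... | z , zu₁ , w' =
    let (_ , z≢u₂ , apart) , _ = target w'
        H , u₁∈H , _ , _ , _ , w'' = extract G (Adj-sym G e) zu₁ (z≢u₂ ∘ ≡.sym)
            (λ u₂z → apart (zu₁ , Adj-sym G u₂z)) (λ _ r → r)
            (step (Adj⇒≢ G e ∘ ≡.sym , λ _ → inj₁ refl) (Adj-sym G qu₂) (mapʷ narrow w'))
    in Adj⇒≢ G e (inX-unique H u₁∈ u₂∈ u₁∈H (proj₁ (source w'')))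
    where
    narrow : ∀ {t} → Apart u₁ u₂ t × (t ≡ z ⊎ ¬ Adj G t u₁) → t ≢ u₁ × (Adj G t u₁ → t ≡ u₂ ⊎ t ≡ z)
    narrow ((n , _) , inj₁ t≡z) = n , λ _ → inj₂ t≡z
    narrow ((n , _) , inj₂ t≁u₁) = n , λ f → contradiction f t≁u₁

  -- The vertex `u₂` is off the hole, which already contains `u₁` from `X`. On the arc only `a A` is
  -- adjacent to `u₁`, and it is not adjacent to `u₂`.
  arcLeg : ∀ {u₁ u₂ w} → u₁ ∈ˢ X → u₂ ∈ˢ X → Adj G u₁ u₂ → (H : Hole G) → u₁ ∈H H → w ∈H H →
    u₁ ≢ w → ¬ Adj G w u₁ → (A : Around H u₁) → ¬ Adj G (a A) u₂ →
    ∃[ y ] (Adj G y u₁ × WalkIn G (Apart u₁ u₂) w y)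
  arcLeg {u₁} {u₂} u₁∈ u₂∈ e H u₁∈H w∈H u₁≢w w≁u₁ A a≁u₂ =
    a A , ab A , reverseʷ (mapʷ apart (arcA A w∈H (u₁≢w ∘ ≡.sym) λ { refl → w≁u₁ (cb A) }))
    where
    apart : ∀ {t} → t ∈H H × t ≢ u₁ × (Adj G t u₁ → t ≡ a A) → Apart u₁ u₂ t
    apart (t∈ , n , f) = n , (λ { refl → Adj⇒≢ G e (inX-unique H u₁∈ u₂∈ u₁∈H t∈) }) ,
      λ { (g , h) → a≁u₂ (subst (λ s → Adj G s u₂) (f g) h) }

  -- If u₂ were adjacent to both neighbours of u₁ on the hole, it would join the two
  -- neighbours of w on the hole without u₁.
  holeLeg : ∀ {u₁ u₂ w} → u₁ ∈ˢ X → u₂ ∈ˢ X → Adj G u₁ u₂ → (H : Hole G) → u₁ ∈H H → w ∈H H →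
    u₁ ≢ w → ¬ Adj G w u₁ → ¬ Adj G w u₂ →
    ∃[ y ] (Adj G y u₁ × WalkIn G (Apart u₁ u₂) w y)
  holeLeg {u₁} {u₂} {w} u₁∈ u₂∈ e H u₁∈H w∈H u₁≢w w≁u₁ w≁u₂ = choose (Adj? G (a A) u₂) (Adj? G (c A) u₂)
    where
    A = aroundVertex H u₁∈H
    choose : Dec (Adj G (a A) u₂) → Dec (Adj G (c A) u₂) → ∃[ y ] (Adj G y u₁ × WalkIn G (Apart u₁ u₂) w y)
    choose (no a≁u₂) _ = arcLeg u₁∈ u₂∈ e H u₁∈H w∈H u₁≢w w≁u₁ A a≁u₂
    choose (yes _) (no c≁u₂) = arcLeg u₁∈ u₂∈ e H u₁∈H w∈H u₁≢w w≁u₁ (reflect A) c≁u₂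
    choose (yes au₂) (yes cu₂) = ⊥-elim (separated G (proj₁ ncX u₁ u₁∈) H u₁∈H B u₁≢w
      (mapʷ (λ { (n , n' , f) → n , n' , inj₁ ∘ f }) (arcToU₂ B) ++ʷ
       reverseʷ (mapʷ (λ { (n , n' , f) → n , n' , inj₂ ∘ f }) (arcToU₂ (reflect B)))))
      where
      B = aroundVertex H w∈H
      arcToU₂ : (B : Around H w) → WalkIn G (λ t → t ≢ u₁ × t ≢ w × (Adj G t w → t ≡ a B)) (a B) u₂
      arcToU₂ B =
        -- The vertex `p` before `u₁` on the arc is a hole-neighbour of `u₁`, hence adjacent to `u₂`
        -- in the present case.
        let p , pu₁ , a⇝p = approach (arcA B u₁∈H u₁≢w (λ { refl → w≁u₁ (Adj-sym G (cb B)) }))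
              (λ a≡u₁ → w≁u₁ (Adj-sym G (subst (λ s → Adj G s w) a≡u₁ (ab B))))
            (p∈H , _) , _ = target a⇝p
            pu₂ = [ (λ p≡a → subst (λ s → Adj G s u₂) (≡.sym p≡a) au₂)
                  , (λ p≡c → subst (λ s → Adj G s u₂) (≡.sym p≡c) cu₂) ]′ (only A p∈H pu₁)
        in snoc (mapʷ (λ { ((_ , n , f) , n') → n' , n , f }) a⇝p) pu₂
             ( Adj⇒≢ G e ∘ ≡.sym , (λ { refl → Adj⇒≢ G e (inX-unique H u₁∈ u₂∈ u₁∈H w∈H) })
             , λ g → contradiction (Adj-sym G g) w≁u₂)

  leg : ∀ {u₁ u₂ w} → u₁ ∈ˢ X → u₂ ∈ˢ X → Adj G u₁ u₂ → ¬ w ∈ˢ X →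
    Adj G u₁ w ⊎ CommonHole G u₁ w → ¬ Adj G w u₂ →
    ∃[ y ] (Adj G y u₁ × WalkIn G (Apart u₁ u₂) w y)
  leg {u₁} {u₂} {w} u₁∈ u₂∈ e w∉ j w≁u₂ with Adj? G w u₁ | j
  ... | yes f | _ = w , f , here ((λ { refl → w∉ u₁∈ }) , (λ { refl → w∉ u₂∈ }) , w≁u₂ ∘ proj₂)
  ... | no w≁u₁ | inj₁ f = contradiction (Adj-sym G f) w≁u₁
  ... | no w≁u₁ | inj₂ (H , u₁∈H , w∈H) =
    holeLeg u₁∈ u₂∈ e H u₁∈H w∈H (λ { refl → w∉ u₁∈ }) w≁u₁ w≁u₂

  chord∉ : ∀ {x y} → Chord G X x y → ¬ y ∈ˢ X
  chord∉ (x∈ , x≢y , H , x∈H , y∈H) y∈ = x≢y (inX-unique H x∈ y∈ x∈H y∈H)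

  module _ {us} (K : Completion G X us) where

    private
      G* = graph K

    bothIn : ∀ {x y} → x ∈ˢ X → y ∈ˢ X → Adj G* x y → Adj G x y
    bothIn x∈ y∈ e with added K e
    ... | inj₁ f = f
    ... | inj₂ (inj₁ ch) = contradiction y∈ (chord∉ ch)
    ... | inj₂ (inj₂ ch) = contradiction x∈ (chord∉ ch)

    bothOut : ∀ {x y} → ¬ x ∈ˢ X → ¬ y ∈ˢ X → Adj G* x y → Adj G x y
    bothOut x∉ y∉ e with added K e
    ... | inj₁ f = f
    ... | inj₂ (inj₁ ch) = contradiction (proj₁ ch) x∉
    ... | inj₂ (inj₂ ch) = contradiction (proj₁ ch) y∉

    joined : ∀ {x y} → Adj G* x y → Adj G x y ⊎ CommonHole G x y
    joined e with added K e
    ... | inj₁ f = inj₁ f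
    ... | inj₂ (inj₁ (_ , _ , h)) = inj₂ h
    ... | inj₂ (inj₂ (_ , _ , h)) = inj₂ (CommonHole-sym h)

    -- The edge between `w₁` and `w₂` is old because both lie outside `X`. With a leg from `w₂` to a
    -- neighbour of `u₁` and a leg from `w₁` to a neighbour of `u₂` it forms a detour excluded by
    -- `noDetour`.
    noDisjointChords : ∀ {u₁ w₁ u₂ w₂} →
      Chord G X u₁ w₁ → ¬ Adj G u₁ w₁ → Chord G X u₂ w₂ → ¬ Adj G u₂ w₂ →
      Adj G* u₁ u₂ → Adj G* w₁ w₂ → Adj G* u₁ w₂ → Adj G* u₂ w₁ → ⊥
    noDisjointChords c₁ n₁ c₂ n₂ uu ww uw wu =
      let u₁∈ = proj₁ c₁ ; u₂∈ = proj₁ c₂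
          e = bothIn u₁∈ u₂∈ uu
          f = bothOut (chord∉ c₁) (chord∉ c₂) ww
          y , yu₁ , w₂⇝y = leg u₁∈ u₂∈ e (chord∉ c₂) (joined uw) (n₂ ∘ Adj-sym G)
          q , qu₂ , w₁⇝q = leg u₂∈ u₁∈ (Adj-sym G e) (chord∉ c₁) (joined wu) (n₁ ∘ Adj-sym G)
          q⇝w₁ = mapʷ (λ { (n , n' , g) → n' , n , λ (x , y) → g (y , x) }) (reverseʷ w₁⇝q)
      in noDetour u₁∈ u₂∈ e qu₂ yu₁ (q⇝w₁ ++ʷ step (target q⇝w₁) f w₂⇝y)

    module Clique {k} (f : Fin (suc k) → Fin N) (f-inj : ∀ i j → f i ≡ f j → i ≡ j)
      (f-adj : ∀ i j → i ≢ j → Adj G* (f i) (f j)) where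

      New : Fin (suc k) → Fin (suc k) → Set
      New i j = Chord G X (f i) (f j) × ¬ Adj G (f i) (f j)

      Centre : Fin (suc k) → Set
      Centre i₀ = ∀ i j → i ≢ i₀ → j ≢ i₀ → i ≢ j → Adj G (f i) (f j)

      classify : ∀ {i j} → i ≢ j → ¬ Adj G (f i) (f j) → New i j ⊎ New j i
      classify i≢j ne with added K (f-adj _ _ i≢j)
      ... | inj₁ e = contradiction e ne
      ... | inj₂ (inj₁ ch) = inj₁ (ch , ne)
      ... | inj₂ (inj₂ ch) = inj₂ (ch , ne ∘ Adj-sym G)

      disjoint : ∀ {i j i' j'} → New i j → New i' j' → i ≢ i' → j ≢ j' → ⊥
      disjoint (c₁ , n₁) (c₂ , n₂) i≢i' j≢j' = noDisjointChords c₁ n₁ c₂ n₂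
        (f-adj _ _ i≢i') (f-adj _ _ j≢j')
        -- An end in `X` of one chord differs from the end outside `X` of the other.
        (f-adj _ _ λ { refl → chord∉ c₂ (proj₁ c₁) }) (f-adj _ _ λ { refl → chord∉ c₁ (proj₁ c₂) })

      centreOr : ∀ i₀ → Centre i₀ ⊎ ∃[ i ] ∃[ j ] (i ≢ i₀ × j ≢ i₀ × New i j)
      centreOr i₀ with any? (λ i → any? λ j →
        ¬? (i ≟ i₀) ×-dec (¬? (j ≟ i₀) ×-dec (¬? (i ≟ j) ×-dec ¬? (Adj? G (f i) (f j)))))
      ... | no none = inj₁ λ i j n₁ n₂ n₃ → decidable-stable (Adj? G (f i) (f j))
              λ ne → none (i , j , n₁ , n₂ , n₃ , ne)
      ... | yes (i , j , n₁ , n₂ , n₃ , ne) =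
              inj₂ ([ (λ new → i , j , n₁ , n₂ , new) , (λ new → j , i , n₂ , n₁ , new) ]′ (classify n₃ ne))

      -- New edges join `X` to its complement and meet pairwise, so they cannot form a triangle and
      -- must form a star. If neither end of one new edge is a centre, the two edges that witness
      -- this are disjoint from it or from each other.
      centre : ∃[ i₀ ] Centre i₀
      centre with centreOr zero
      ... | inj₁ z = zero , z
      ... | inj₂ (i₀ , j₀ , _ , _ , new₀) with centreOr i₀
      ...   | inj₁ z = i₀ , z
      ...   | inj₂ (i₁ , j₁ , i₁≢i₀ , _ , new₁) with j₁ ≟ j₀
      ...     | no j₁≢j₀ = ⊥-elim (disjoint new₁ new₀ i₁≢i₀ j₁≢j₀)
      ...     | yes refl with centreOr j₀
      ...       | inj₁ z = j₀ , z
      ...       | inj₂ (i₂ , j₂ , _ , j₂≢j₀ , new₂) with i₂ ≟ i₀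
      ...         | no i₂≢i₀ = ⊥-elim (disjoint new₂ new₀ i₂≢i₀ j₂≢j₀)
      ...         | yes refl = ⊥-elim (disjoint new₂ new₁ (i₁≢i₀ ∘ ≡.sym) j₂≢j₀)

      smallerClique : HasClique G k
      smallerClique = let i₀ , z = centre in
        f ∘ punchIn i₀
        , (λ i j e → punchIn-injective i₀ i j (f-inj _ _ e))
        , λ i j i≢j → z _ _ (punchInᵢ≢i i₀ i) (punchInᵢ≢i i₀ j) (i≢j ∘ punchIn-injective i₀ i j)

      -- The branch set of the centre is its component after the other clique vertices are deleted.
      module Minor (i₀ : Fin (suc k)) (z : Centre i₀) where

        Other Branch : Fin N → Set
        Other x = ∃[ j ] (j ≢ i₀ × f j ≡ x)
        Branch = WalkIn G (¬_ ∘ Other) (f i₀)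

        other? : Decidable Other
        other? x = any? λ j → ¬? (j ≟ i₀) ×-dec (f j ≟ x)

        branch₀ : Branch (f i₀)
        branch₀ = here λ { (j , j≢i₀ , e) → j≢i₀ (f-inj _ _ e) }

        -- If the edge is new, take a hole through both ends. The hole-neighbours of `f j` are not
        -- adjacent, so one of them is outside the rest of the clique. The arc from it to the centre
        -- avoids that rest, whose vertices are all adjacent to `f j`.
        touch : ∀ j → j ≢ i₀ → ∃[ x ] (Branch x × Adj G x (f j))
        touch j j≢i₀ with Adj? G (f i₀) (f j) | joined (f-adj i₀ j (j≢i₀ ∘ ≡.sym))
        ... | yes e | _ = f i₀ , branch₀ , e
        ... | no ne | inj₁ e = contradiction e ne
        ... | no ne | inj₂ (H , i₀∈ , j∈) = through (other? (a A)) (other? (c A))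
          where
          A = aroundVertex H j∈
          clear : ∀ {s} → ¬ Other s → ∀ {t} → t ∈H H × t ≢ f j × (Adj G t (f j) → t ≡ s) → ¬ Other t
          clear free (_ , t≢fj , g) (l , l≢i₀ , refl) = free (l , l≢i₀ , g (z l j l≢i₀ j≢i₀ λ { refl → t≢fj refl }))
          ≢end : ∀ {s} → Adj G s (f j) → f i₀ ≢ s
          ≢end e refl = ne e
          i₀≢j : f i₀ ≢ f j
          i₀≢j e = j≢i₀ (≡.sym (f-inj _ _ e))
          through : Dec (Other (a A)) → Dec (Other (c A)) → ∃[ x ] (Branch x × Adj G x (f j))
          through (no free) _ = a A , reverseʷ (mapʷ (clear free) (arcA A i₀∈ i₀≢j (≢end (cb A)))) , ab A
          through (yes _) (no free) = c A , reverseʷ (mapʷ (clear free) (arcC A i₀∈ i₀≢j (≢end (ab A)))) , cb A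
          through (yes (l , l≢ , la)) (yes (l' , l'≢ , l'c)) =
            contradiction (subst₂ (Adj G) la l'c (z l l' l≢ l'≢ λ { refl → a≢c A (≡.trans (≡.sym la) l'c) })) (a≁c A)

        module _ (branch? : ∀ x → Dec (Branch x)) where

          label : ∀ {x} → Dec (Other x) → Dec (Branch x) → Maybe (Fin (suc k))
          label (yes (j , _)) _ = just j
          label (no _) (yes _) = just i₀
          label (no _) (no _) = nothing

          β : Fin N → Maybe (Fin (suc k))
          β x = label (other? x) (branch? x)

          β-other : ∀ {j} → j ≢ i₀ → β (f j) ≡ just j
          β-other {j} j≢i₀ with other? (f j)
          ... | yes (j' , _ , e) = cong just (f-inj _ _ e)
          ... | no ¬o = contradiction (j , j≢i₀ , refl) ¬o

          β-branch : ∀ {x} → Branch x → β x ≡ just i₀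
          β-branch {x} b with other? x | branch? x
          ... | yes o | _ = contradiction o (target b)
          ... | no _ | yes _ = refl
          ... | no _ | no ¬b = contradiction b ¬b

          β-inv : ∀ {x i} → β x ≡ just i → (i ≢ i₀ × f i ≡ x) ⊎ (i ≡ i₀ × Branch x)
          β-inv {x} e with other? x | branch? x
          β-inv refl | yes (_ , o) | _ = inj₁ o
          β-inv refl | no _ | yes b = inj₂ (refl , b)

          minor : HasKMinor G (suc k)
          minor = β , nonempty , connected , adjacent
            where
            nonempty : ∀ i → ∃[ x ] (β x ≡ just i)
            nonempty i with i ≟ i₀
            ... | yes refl = f i₀ , β-branch branch₀
            ... | no i≢i₀ = f i , β-other i≢i₀
            connected : ∀ i x y → β x ≡ just i → β y ≡ just i → WalkIn G (λ t → β t ≡ just i) x y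
            connected i x y ex ey with β-inv ex | β-inv ey
            ... | inj₁ (_ , refl) | inj₁ (_ , refl) = here ex
            ... | inj₁ (ne , _) | inj₂ (eq , _) = contradiction eq ne
            ... | inj₂ (eq , _) | inj₁ (ne , _) = contradiction eq ne
            ... | inj₂ (refl , bx) | inj₂ (_ , by) =
              reverseʷ (mapʷ β-branch (prefixes bx)) ++ʷ mapʷ β-branch (prefixes by)
            adjacent : ∀ i j → i ≢ j → ∃[ x ] ∃[ y ] (β x ≡ just i × β y ≡ just j × Adj G x y)
            adjacent i j i≢j with i ≟ i₀ | j ≟ i₀
            ... | no i≢i₀ | no j≢i₀ = f i , f j , β-other i≢i₀ , β-other j≢i₀ , z i j i≢i₀ j≢i₀ i≢j
            ... | yes refl | yes refl = contradiction refl i≢j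
            ... | yes refl | no j≢i₀ = let x , bx , e = touch j j≢i₀ in
              x , f j , β-branch bx , β-other j≢i₀ , e
            ... | no i≢i₀ | yes refl = let x , bx , e = touch i i≢i₀ in
              f i , x , β-other i≢i₀ , β-branch bx , Adj-sym G e

      cliqueMinor : ¬ ¬ HasKMinor G (suc k)
      cliqueMinor no-minor = let i₀ , z = centre in
        ∀-dec (Minor.Branch i₀ z) λ branch? → no-minor (Minor.minor i₀ z branch?)

-- Greedy colouring of chordal graphs

comprehension : {P : Fin N → Set} → (∀ z → Dec (P z)) →
  Σ (Subset N) λ S → (∀ {z} → z ∈ˢ S → P z) × (∀ {z} → P z → z ∈ˢ S)
comprehension {P = P} P? = S , (λ {z} z∈ → witness (P? z) (≡.trans (≡.sym (lookup∘tabulate _ z)) ([]=⇒lookup z∈)))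
  , (λ {z} pz → lookup⇒[]= z S (≡.trans (lookup∘tabulate _ z) (dec-true (P? z) pz)))
  where
  S = tabulate (λ z → does (P? z))

module Chordal (G : Graph N) (chordal : ¬ Hole G) where

  Simplicial : Subset N → Fin N → Set
  Simplicial S s = s ∈ˢ S × (∀ {x y} → x ∈ˢ S → y ∈ˢ S → Adj G x s → Adj G y s → x ≢ y → Adj G x y)

  -- Dirac's argument: a component of the non-neighbours of a vertex x, together with its
  -- boundary (a clique), contains by induction a vertex off the boundary that is simplicial in it, hence in S.
  simplicial : ∀ S → Acc _⊂_ S → (B : Fin N → Set) → (∀ {x y} → B x → B y → x ≢ y → Adj G x y) →
    ∀ {z} → z ∈ˢ S → ¬ B z → ¬ ¬ (∃[ s ] (Simplicial S s × ¬ B s))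
  simplicial S (acc rec) B B-clique {z} z∈S z∉B k =
    -- If some `x` in `B` has a non-neighbour, a simplicial vertex not adjacent to `x` is off the
    -- clique `B`. Otherwise vertices of `B` see all of `S`, and any non-adjacent pair serves. If
    -- there is no such pair, `S` is a clique and `z` itself is simplicial.
    ¬¬-excluded-middle {A = ∃[ x ] ∃[ y ] (NonAdj x y × B x)} λ
      { (yes (x , y , p , x∈B)) → awayFrom p λ (s , simp , s≢x , s≁x) →
          k (s , simp , λ s∈B → s≁x (B-clique s∈B x∈B s≢x))
      ; (no none) → ¬¬-excluded-middle {A = ∃[ x ] ∃[ y ] NonAdj x y} λ
        { (yes (x , y , p)) → awayFrom p λ (s , simp , s≢x , s≁x) →
            k (s , simp , λ s∈B → none (s , x , (proj₁ simp , proj₁ p , s≢x , s≁x) , s∈B))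
        ; (no complete) → k (z , (z∈S , λ x∈ y∈ _ _ x≢y →
            decidable-stable (Adj? G _ _) λ x≁y → complete (_ , _ , x∈ , y∈ , x≢y , x≁y)) , z∉B) } }
    where
    NonAdj : Fin N → Fin N → Set
    NonAdj x y = x ∈ˢ S × y ∈ˢ S × x ≢ y × ¬ Adj G x y
    awayFrom : ∀ {x y} → NonAdj x y → ¬ ¬ (∃[ s ] (Simplicial S s × s ≢ x × ¬ Adj G s x))
    awayFrom {x} {y} (x∈S , y∈S , x≢y , x≁y) k' =
      ∀-dec K λ K? → ∀-dec B' λ B'? → restrict K? B'?
      where
      Q K B' : Fin N → Set
      Q t = t ∈ˢ S × t ≢ x × ¬ Adj G t x
      K = WalkIn G Q y
      B' t = t ∈ˢ S × ¬ K t × ∃[ q ] (K q × Adj G t q)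
      y∈K : K y
      y∈K = here (y∈S , x≢y ∘ ≡.sym , x≁y ∘ Adj-sym G)
      B'⇒Adj : ∀ {t} → B' t → Adj G t x
      B'⇒Adj {t} (t∈S , t∉K , q , q∈K , tq) = decidable-stable (Adj? G t x) λ t≁x →
        t∉K (snoc q∈K (Adj-sym G tq) (t∈S , (λ { refl → proj₂ (proj₂ (target q∈K)) (Adj-sym G tq) }) , t≁x))
      -- Two non-adjacent boundary vertices would be joined through the component `K`, and `x` would
      -- close this walk to a hole.
      B'-clique : ∀ {s t} → B' s → B' t → s ≢ t → Adj G s t
      B'-clique {s} {t} s∈ t∈ s≢t = decidable-stable (Adj? G s t) λ s≁t →
        let _ , _ , q , q∈K , sq = s∈
            _ , _ , r , r∈K , tr = t∈
            sx = B'⇒Adj s∈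
            tx = B'⇒Adj t∈
            inner = λ {v} (Qv : Q v) → proj₁ (proj₂ Qv) , λ e → contradiction e (proj₂ (proj₂ Qv))
        in chordal (proj₁ (extract G {R = λ v → v ≢ x × (Adj G v x → v ≡ s ⊎ v ≡ t)} sx tx s≢t s≁t (λ _ p → p)
             (step (Adj⇒≢ G sx , λ _ → inj₁ refl) sq
               (snoc (mapʷ inner (reverseʷ q∈K) ++ʷ mapʷ inner r∈K) (Adj-sym G tr)
                 (Adj⇒≢ G tx , λ _ → inj₂ refl)))))
      restrict : (∀ t → Dec (K t)) → (∀ t → Dec (B' t)) → ⊥
      restrict K? B'? =
        let S' , ∈S'⇒ , ⇒∈S' = comprehension (λ t → K? t ⊎-dec B'? t)
            S'⊂S = (λ {t} t∈ → [ proj₁ ∘ target , proj₁ ]′ (∈S'⇒ t∈))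
                 , x , x∈S , λ x∈S' → [ (λ x∈K → proj₁ (proj₂ (target x∈K)) refl)
                                      , (λ x∈B' → Adj⇒≢ G (B'⇒Adj x∈B') refl) ]′ (∈S'⇒ x∈S')
        in simplicial S' (rec S'⊂S) B' B'-clique (⇒∈S' (inj₁ y∈K)) (λ (_ , y∉K , _) → y∉K y∈K)
          λ (s , (s∈S' , simp) , s∉B') →
            let s∈K = [ id , (λ s∈B' → contradiction s∈B' s∉B') ]′ (∈S'⇒ s∈S')
                s∈S , s≢x , s≁x = target s∈K
                nbr∈S' = λ {t} (t∈S : t ∈ˢ S) (ts : Adj G t s) → ⇒∈S' {t} (neighbour K? t∈S ts s∈K)
            in k' (s , (s∈S , λ p∈ q∈ ps qs → simp (nbr∈S' p∈ ps) (nbr∈S' q∈ qs) ps qs) , s≢x , s≁x)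
        where
        neighbour : (∀ t → Dec (K t)) → ∀ {s t} → t ∈ˢ S → Adj G t s → K s → K t ⊎ B' t
        neighbour K? {s} {t} t∈S ts s∈K with K? t
        ... | yes t∈K = inj₁ t∈K
        ... | no t∉K = inj₂ (t∈S , t∉K , s , s∈K , ts)

  -- A default for vertices not yet coloured. With no colours at hand, a single vertex is already
  -- the excluded clique.
  someColour : ∀ k → ¬ HasClique G (suc k) → Fin N → Fin k
  someColour zero noClique x = contradiction
    ((λ _ → x) , (λ { zero zero _ → refl }) , λ { zero zero n → contradiction refl n }) noClique
  someColour (suc _) _ _ = zero

  module _ {k} (𝓗 : Cover G k) (noClique : ¬ HasClique G (suc k)) where

    ColoursOn : Subset N → (Fin N → Fin k) → Set
    ColoursOn S f = ∀ u v → u ∈ˢ S → v ∈ˢ S → Adj G u v → M 𝓗 u v (f u) (f v) ≡ false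

    -- Were every colour blocked at s, the blocking neighbours would be distinct, since the
    -- cover is a matching, and would form with s a clique of k + 1 vertices.
    freeColour : ∀ {S s} → Simplicial S s → (f : Fin N → Fin k) →
      ∃[ i ] (∀ v → v ∈ˢ S → Adj G v s → M 𝓗 s v i (f v) ≡ false)
    freeColour {S} {s} (_ , simp) f
      with any? (λ i → ¬? (any? λ v → (v ∈ˢ? S) ×-dec (Adj? G v s ×-dec (M 𝓗 s v i (f v) Boolₚ.≟ true))))
    ... | yes (i , free) = i , λ v v∈ vs → Boolₚ.¬-not λ e → free (v , v∈ , vs , e)
    ... | no allBlocked = ⊥-elim (noClique (g , g-inj , g-adj))
      where
      Blocker : Fin k → Set
      Blocker i = ∃[ v ] (v ∈ˢ S × Adj G v s × M 𝓗 s v i (f v) ≡ true)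
      blocker : ∀ i → Blocker i
      blocker i = decidable-stable
        (any? λ v → (v ∈ˢ? S) ×-dec (Adj? G v s ×-dec (M 𝓗 s v i (f v) Boolₚ.≟ true)))
        λ none → allBlocked (i , none)
      b : Fin k → Fin N
      b = proj₁ ∘ blocker
      b-adj : ∀ i → Adj G (b i) s
      b-adj i = proj₁ (proj₂ (proj₂ (blocker i)))
      b-inj : ∀ i j → b i ≡ b j → i ≡ j
      b-inj i j e = match₂ 𝓗 s (b j) i j (f (b j))
        (subst (λ v → M 𝓗 s v i (f v) ≡ true) e (proj₂ (proj₂ (proj₂ (blocker i)))))
        (proj₂ (proj₂ (proj₂ (blocker j))))
      g : Fin (suc k) → Fin N
      g zero = s
      g (suc i) = b i
      g-inj : ∀ i j → g i ≡ g j → i ≡ j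
      g-inj zero zero _ = refl
      g-inj zero (suc j) e = contradiction (≡.sym e) (Adj⇒≢ G (b-adj j))
      g-inj (suc i) zero e = contradiction e (Adj⇒≢ G (b-adj i))
      g-inj (suc i) (suc j) e = cong suc (b-inj i j e)
      g-adj : ∀ i j → i ≢ j → Adj G (g i) (g j)
      g-adj zero zero n = contradiction refl n
      g-adj zero (suc j) _ = Adj-sym G (b-adj j)
      g-adj (suc i) zero _ = b-adj i
      g-adj (suc i) (suc j) n = simp (proj₁ (proj₂ (blocker i))) (proj₁ (proj₂ (blocker j)))
        (b-adj i) (b-adj j) λ e → n (cong suc (b-inj i j e))

    colouringOn : ∀ S → Acc _⊂_ S → ¬ ¬ (∃[ f ] ColoursOn S f)
    colouringOn S (acc rec) κ with nonemptyˢ? S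
    ... | no empty = κ (someColour k noClique , λ u v u∈ _ _ → contradiction (u , u∈) empty)
    -- The clique to be avoided is empty here; it serves only the induction for `simplicial`.
    ... | yes (z , z∈S) = simplicial S (acc rec) (λ _ → ⊥) (λ ()) z∈S id λ (s , simp , _) →
      colouringOn (S - s) (rec (x∈p⇒p-x⊂p (proj₁ simp))) λ (f , fOK) → extend simp f fOK
      where
      extend : ∀ {s} → Simplicial S s → (f : Fin N → Fin k) → ColoursOn (S - s) f → ⊥
      extend {s} simp f fOK = κ (f' , ok)
        where
        i = proj₁ (freeColour simp f)
        f' : Fin N → Fin k
        f' v = if does (v ≟ s) then i else f v
        ok : ColoursOn S f'
        ok u v u∈ v∈ e with u ≟ s | v ≟ s
        ... | yes refl | yes refl = contradiction refl (Adj⇒≢ G e)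
        ... | yes refl | no _ = proj₂ (freeColour simp f) v v∈ (Adj-sym G e)
        ... | no _ | yes refl = ≡.trans (symM 𝓗 u v (f u) i) (proj₂ (freeColour simp f) u u∈ e)
        ... | no u≢s | no v≢s = fOK u v (x∈p∧x≢y⇒x∈p-y u∈ u≢s) (x∈p∧x≢y⇒x∈p-y v∈ v≢s) e

    colouring : ¬ ¬ (∃[ f ] DPColouring 𝓗 f)
    colouring κ = colouringOn ⊤ (⊂-wellFounded ⊤) λ (f , ok) → κ (f , λ u v → ok u v ∈⊤ ∈⊤)

-- From the completion to colourings of the original graph.

-- Maps between finite sets are coded by the elements of one finite set, so a colouring can be found
-- by search and the double negation removed.
colourable-stable : ∀ {G : Graph N} {k} (𝓗 : Cover G k) → ¬ ¬ (∃[ f ] DPColouring 𝓗 f) → ∃[ f ] DPColouring 𝓗 f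
colourable-stable {G = G} 𝓗 ¬¬f =
  let c , ok = decidable-stable (any? λ c → dp? (finToFun c)) λ none →
        ¬¬f λ (f , ok) → none (funToFin f , λ u v e →
          subst₂ (λ i j → M 𝓗 u v i j ≡ false) (≡.sym (finToFun-funToFin f u)) (≡.sym (finToFun-funToFin f v)) (ok u v e))
  in finToFun c , ok
  where
  dp? : ∀ f → Dec (DPColouring 𝓗 f)
  dp? f = all? λ u → all? λ v → Adj? G u v →-dec (M 𝓗 u v (f u) (f v) Boolₚ.≟ false)

colourable : ∀ {G : Graph N} {X : Subset N} → HoleCover G X → (∀ u → u ∈ˢ X → VertexNC G u) →
  ∀ k → ((K : Completion G X (allFin N)) → ¬ HasClique (graph K) (suc k)) → DPColourable G k
colourable {N} {G} {X} cover nc k noClique 𝓗 = colourable-stable 𝓗 λ κ →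
  completion G X nc (allFin N) λ K →
    -- The fields of a cover do not mention edges, so the same matchings cover the completion; a
    -- colouring there respects all edges of `G`.
    let 𝓗' = record { M = M 𝓗 ; symM = symM 𝓗 ; match₁ = match₁ 𝓗 ; match₂ = match₂ 𝓗 }
    in Chordal.colouring (graph K) (completion-chordal cover K) 𝓗' (noClique K)
         λ (f , ok) → κ (f , λ u v e → ok u v (extends K e))

theorem2p1 : ∀ {N : ℕ} (G : Graph N) → NCGraph G →
    ((w : ℕ) → IsCliqueNumber G w → χDP≤ G (suc w))
    × ((n : ℕ) → KMinorFree G n → χDP≤ G (n ∸ 1))
theorem2p1 {N} G (X , cover , ncX) = byClique , byMinor
  where
  byClique : (w : ℕ) → IsCliqueNumber G w → χDP≤ G (suc w)
  -- A clique of order `w + 2` in the completion loses its centre and leaves one of order `w + 1` in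
  -- `G`.
  byClique w (_ , noClique) = suc w , ℕₚ.≤-refl , colourable cover (proj₁ ncX) (suc w)
    λ K (f , f-inj , f-adj) → noClique (NCSet.Clique.smallerClique G X ncX K f f-inj f-adj)
  byMinor : (n : ℕ) → KMinorFree G n → χDP≤ G (n ∸ 1)
  -- The empty family of branch sets is a minor of order zero, so this case is void.
  byMinor zero free = contradiction ((λ _ → nothing) , (λ ()) , (λ ()) , λ ()) free
  byMinor (suc k) free = k , ℕₚ.≤-refl , colourable cover (proj₁ ncX) k
    λ K (f , f-inj , f-adj) → NCSet.Clique.cliqueMinor G X ncX K f f-inj f-adj free
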